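{- Henson's graph $U_3$ satisfies property $\mathscr{D}_3$ but does not satisfy property $\mathscr{D}_4$.
   Context: Henson's graph $U_3$ is the countable triangle-free graph (unique up to isomorphism) with the extension property: for all disjoint finite sets $A,B\subseteq V(U_3)$ with $A$ independent there is a vertex $v\notin A\cup B$ adjacent to every vertex of $A$ and to no vertex of $B$. Property $\mathscr{D}_k$: for every $m\in\{1,\dots,k\}$ and every sequence $x_1,\dots,x_{3m}$ of (not necessarily distinct) vertices there is a vertex $y$ with $|\{i\in[3m]: x_iy\in E(G)\}|\ge m+1$. -}

module Defs where

open import Level using (Level; _⊔_) renaming (suc to lsuc)
open import Data.Nat using (ℕ; suc; _*_; _≤_)
open import Data.Fin using (Fin)
open import Data.List using (List; length; filter; allFin)
open import Data.List.Membership.Propositional using (_∈_; _∉_)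
open import Data.List.Relation.Binary.Disjoint.Propositional using (Disjoint)
open import Data.Product using (∃-syntax; _×_)
open import Function.Bundles using (_↣_)
open import Relation.Binary.Definitions using (Symmetric; Irreflexive; Decidable)
open import Relation.Binary.PropositionalEquality using (_≡_)
open import Relation.Nullary using (¬_)

-- Adjacency is a decidable relation, i.e. it has a characteristic function,
-- which is automatic classically. The field _~?_ is what makes the number of
-- indices counted in degreeInto below a natural number.
record Graph (v e : Level) : Set (lsuc (v ⊔ e)) where
  infix 4 _~_ _~?_
  field
    V        : Set v
    _~_      : V → V → Set e
    ~-sym    : Symmetric _~_
    ~-irrefl : Irreflexive _≡_ _~_
    _~?_     : Decidable _~_

module _ {v e : Level} (G : Graph v e) where
  open Graph G

  TriangleFree : Set (v ⊔ e)
  TriangleFree = ∀ {x y z} → x ~ y → y ~ z → ¬ (x ~ z)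

  -- Finite vertex sets are represented by lists, read through _∈_ only, so
  -- order and repetitions in the list are irrelevant.
  Independent : List V → Set (v ⊔ e)
  Independent A = ∀ {x y} → x ∈ A → y ∈ A → ¬ (x ~ y)

  ExtensionProperty : Set (v ⊔ e)
  ExtensionProperty =
    ∀ (A B : List V) → Disjoint A B → Independent A →
    ∃[ w ] w ∉ A × w ∉ B × (∀ {a} → a ∈ A → w ~ a) × (∀ {b} → b ∈ B → ¬ (w ~ b))

  -- Henson's graph is determined up to isomorphism by these properties.
  -- Countable means "injects into ℕ"; the extension property forces V to be
  -- infinite.
  record IsHensonU₃ : Set (v ⊔ e) where
    field
      countable    : V ↣ ℕ
      triangleFree : TriangleFree
      extension    : ExtensionProperty

  -- |{ i : x i ~ y }|, counting indices rather than distinct vertices.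
  degreeInto : ∀ {n} → (Fin n → V) → V → ℕ
  degreeInto {n} x y = length (filter (λ i → x i ~? y) (allFin n))

  𝒟 : ℕ → Set v
  𝒟 k = ∀ m → 1 ≤ m → m ≤ k → (x : Fin (3 * m) → V) →
        ∃[ y ] suc m ≤ degreeInto x y

{-# OPTIONS --safe #-}

-- A neighbour of every vertex of an independent set is given by the extension property, and every
-- neighbourhood is independent. So the m-th clause of 𝒟 asks that among any 3m vertices some m + 1
-- be independent.
-- For m = 1, 2, 3 this is the Ramsey bound R(3, m + 1) ≤ 3m, i.e. R(3,2) ≤ 3, R(3,3) ≤ 6 and
-- R(3,4) ≤ 9, the last by parity: on 9 vertices without triangle or independent 4-set all
-- degrees would be 3, and 9 · 3 is odd. For m = 4 it fails because R(3,5) > 12: the extension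
-- property embeds in U₃ the Cayley graph of ℤ/13 with connection set {1, 5, 8, 12} minus a
-- vertex, which is triangle-free with independence number 4.
module Submission where

open import Level using (Level; 0ℓ)
open import Data.Bool using (true; false)
open import Data.Fin using (Fin; zero; suc; toℕ)
open import Data.Fin.Properties using (all?)
open import Data.List using (List; []; _∷_; [_]; _++_; length; filter; map; allFin; tabulate)
open import Data.List.Membership.Propositional using (_∈_; find)
open import Data.List.Membership.Propositional.Properties
  using (∈-filter⁻; ∈-filter⁺; ∈-map⁻; ∈-map⁺; ∈-∃++; ∈-allFin; ∈-++⁺ˡ)
open import Data.List.Properties using (filter-reject; filter-all; filter-++; length-++; length-tabulate)
open import Data.List.Relation.Binary.Permutation.Propositional
  using (_↭_; prep; ↭-refl; ↭-sym; ↭-trans; module PermutationReasoning)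
open import Data.List.Relation.Binary.Permutation.Propositional.Properties
  using (↭-length; filter-↭; shift; ++⁺ʳ; ++-assoc; ++-comm; ∈-resp-↭)
open import Data.List.Relation.Binary.Sublist.Propositional using (_⊆_; []; _∷_; _∷ʳ_)
open import Data.List.Relation.Binary.Sublist.Propositional.Properties using (filter-⊆)
open import Data.List.Relation.Unary.All as All using (All; []; _∷_)
open import Data.List.Relation.Unary.All.Properties using (¬All⇒Any¬)
open import Data.List.Relation.Unary.Any using (here; there; any?)
open import Data.Nat using (ℕ; zero; suc; _+_; _*_; _≤_; _⊔_; z≤n; s≤s; ∣_-_∣; _≤?_; _≟_)
open import Data.List.Membership.DecPropositional _≟_ using (_∈?_)
open import Data.Nat.Divisibility using (_∣_; _∣?_; ∣m∣n⇒∣m+n; _∣0; m∣m*n)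
open import Data.Nat.ListAction using (sum)
open import Data.Nat.Properties
  using (+-assoc; +-identityʳ; +-cancelˡ-≤; +-monoˡ-≤; ≤-trans; ≤-refl; ≤-reflexive; ≮⇒≥;
         <⇒≱; <-cmp; suc-injective; m≤m+n; m≤n⇒m≤n⊔o; m≤n⇒m≤o⊔n; ∣-∣-comm; +-commutativeSemigroup;
         module ≤-Reasoning)
open import Algebra.Properties.CommutativeSemigroup +-commutativeSemigroup using (x∙yz≈y∙xz)
open import Data.Product using (_×_; _,_; ∃-syntax; ∃₂; proj₂)
open import Function using (_∘_; Injective)
open import Relation.Binary.Core using (Rel)
open import Relation.Binary.Definitions using (Symmetric; Decidable; tri<; tri≈; tri>)
open import Relation.Binary.PropositionalEquality
  using (_≡_; _≢_; refl; sym; trans; cong; cong₂; subst; subst₂; module ≡-Reasoning)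
open import Relation.Nullary using (¬_; yes; no; does; ¬?; contradiction)
open import Relation.Nullary.Decidable using (from-yes; from-no; _→-dec_)
import Relation.Unary as U
open import Defs

-- Counting in lists.

filter-partition-↭ : ∀ {a p} {A : Set a} {P : A → Set p} (P? : U.Decidable P) (l : List A) →
                     filter P? l ++ filter (¬? ∘ P?) l ↭ l
filter-partition-↭ P? []      = ↭-refl
filter-partition-↭ P? (x ∷ l) with does (P? x)
... | true  = prep x (filter-partition-↭ P? l)
... | false = ↭-trans (shift x (filter P? l) _) (prep x (filter-partition-↭ P? l))

-- Links counting indices, as `degreeInto` does, to counting entries of the list of values.
length-filter-tabulate : ∀ {a b p n} {A : Set a} {B : Set b} {P : B → Set p}
                         (P? : U.Decidable P) (f : A → B) (g : Fin n → A) →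
                         length (filter P? (tabulate (f ∘ g))) ≡
                         length (filter (P? ∘ f) (tabulate g))
length-filter-tabulate {n = zero}  P? f g = refl
length-filter-tabulate {n = suc n} P? f g with does (P? (f (g zero)))
... | true  = cong suc (length-filter-tabulate P? f (g ∘ suc))
... | false = length-filter-tabulate P? f (g ∘ suc)

sum-map-const : ∀ {a} {A : Set a} {f : A → ℕ} {c} {l : List A} →
                All (λ x → f x ≡ c) l → sum (map f l) ≡ length l * c
sum-map-const []       = refl
sum-map-const (e ∷ es) = cong₂ _+_ e (sum-map-const es)

-- Ramsey bounds R(3, k) in a triangle-free graph.

module Ramsey {v e} (G : Graph v e) (triangleFree : TriangleFree G) where
  open Graph G

  neighbours nonNeighbours : V → List V → List V
  neighbours    x = filter (x ~?_)
  nonNeighbours x = filter (¬? ∘ (x ~?_))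

  deg : List V → V → ℕ
  deg l x = length (neighbours x l)

  deg-split : ∀ x l → deg l x + length (nonNeighbours x l) ≡ length l
  deg-split x l = trans (sym (length-++ (neighbours x l)))
                        (↭-length (filter-partition-↭ (x ~?_) l))

  deg-cons-self : ∀ x l → deg (x ∷ l) x ≡ deg l x
  deg-cons-self x l = cong length (filter-reject (x ~?_) (~-irrefl refl))

  deg-↭ : ∀ {l l′} x → l ↭ l′ → deg l x ≡ deg l′ x
  deg-↭ x p = ↭-length (filter-↭ (x ~?_) p)

  -- `ys` is separate from `l` so that the induction can shrink it alone. By symmetry, `x` counts in
  -- the degree of `y` exactly when `y` counts in that of `x`.
  sum-deg-cons : ∀ x l ys → sum (map (deg (x ∷ l)) ys) ≡ deg ys x + sum (map (deg l) ys)
  sum-deg-cons x l []       = refl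
  sum-deg-cons x l (y ∷ ys) with y ~? x | x ~? y
  ... | yes y~x | no x≁y  = contradiction (~-sym y~x) x≁y
  ... | no y≁x  | yes x~y = contradiction (~-sym x~y) y≁x
  ... | yes _   | yes _   = cong suc (trans (cong (deg l y +_) (sum-deg-cons x l ys))
                                            (x∙yz≈y∙xz (deg l y) (deg ys x) _))
  ... | no _    | no _    = trans (cong (deg l y +_) (sum-deg-cons x l ys))
                                  (x∙yz≈y∙xz (deg l y) (deg ys x) _)

  -- Handshake lemma: a new vertex contributes its degree once in its own term and once more spread
  -- over the terms of its neighbours.
  2∣sum-deg : ∀ l → 2 ∣ sum (map (deg l) l)
  2∣sum-deg []      = 2 ∣0
  2∣sum-deg (x ∷ l) = subst (2 ∣_) (sym doubled) (∣m∣n⇒∣m+n (m∣m*n (deg l x)) (2∣sum-deg l))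
    where
    open ≡-Reasoning
    S = sum (map (deg l) l)
    doubled : sum (map (deg (x ∷ l)) (x ∷ l)) ≡ 2 * deg l x + S
    doubled = begin
      deg (x ∷ l) x + sum (map (deg (x ∷ l)) l) ≡⟨ cong₂ _+_ (deg-cons-self x l) (sum-deg-cons x l l) ⟩
      deg l x + (deg l x + S)                   ≡⟨ +-assoc (deg l x) _ S ⟨
      deg l x + deg l x + S                     ≡⟨ cong (λ d → deg l x + d + S) (+-identityʳ (deg l x)) ⟨
      2 * deg l x + S                           ∎

  neighbours-independent : ∀ x l → Independent G (neighbours x l)
  neighbours-independent x l y∈ z∈ y~z =
    triangleFree (proj₂ (∈-filter⁻ (x ~?_) {xs = l} y∈)) y~z (proj₂ (∈-filter⁻ (x ~?_) {xs = l} z∈))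

  -- Lists are multisets here, since the vertices in 𝒟 may repeat: s is selected by position.
  HasIndependent : ℕ → List V → Set _
  HasIndependent k l = ∃₂ λ s t → s ++ t ↭ l × Independent G s × k ≤ length s

  HasIndependent-resp-↭ : ∀ {k l l′} → l ↭ l′ → HasIndependent k l → HasIndependent k l′
  HasIndependent-resp-↭ p (s , t , q , rest) = s , t , ↭-trans q p , rest

  fromNeighbours : ∀ {k} x l → k ≤ deg l x → HasIndependent k (x ∷ l)
  fromNeighbours x l k≤deg =
    neighbours x l , x ∷ nonNeighbours x l ,
    ↭-trans (shift x (neighbours x l) _) (prep x (filter-partition-↭ (x ~?_) l)) ,
    neighbours-independent x l , k≤deg

  -- `x` extends any independent selection among its non-neighbours; its neighbours join the
  -- unselected part.
  fromNonNeighbours : ∀ {k} x l → HasIndependent k (nonNeighbours x l) →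
                      HasIndependent (suc k) (x ∷ l)
  fromNonNeighbours x l (s , t , p , indep , k≤) =
    x ∷ s , t ++ neighbours x l , prep x perm , indep′ , s≤s k≤
    where
    open PermutationReasoning
    perm : s ++ t ++ neighbours x l ↭ l
    perm = begin
      s ++ t ++ neighbours x l               ↭⟨ ++-assoc s t _ ⟨
      (s ++ t) ++ neighbours x l             ↭⟨ ++⁺ʳ _ p ⟩
      nonNeighbours x l ++ neighbours x l    ↭⟨ ++-comm (nonNeighbours x l) _ ⟩
      neighbours x l ++ nonNeighbours x l    ↭⟨ filter-partition-↭ (x ~?_) l ⟩
      l                                      ∎
    x≁s : ∀ {y} → y ∈ s → ¬ (x ~ y)
    x≁s y∈s = proj₂ (∈-filter⁻ (¬? ∘ (x ~?_)) {xs = l} (∈-resp-↭ p (∈-++⁺ˡ y∈s)))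
    indep′ : Independent G (x ∷ s)
    indep′ (here refl) (here refl) = ~-irrefl refl
    indep′ (here refl) (there z∈)  = x≁s z∈
    indep′ (there y∈)  (here refl) = x≁s y∈ ∘ ~-sym
    indep′ (there y∈)  (there z∈)  = indep y∈ z∈

  -- R(3, k) ≤ n
  RamseyBound : ℕ → ℕ → Set _
  RamseyBound k n = ∀ l → n ≤ length l → HasIndependent k l

  ramsey-0 : RamseyBound 0 0
  ramsey-0 l _ = [] , l , ↭-refl , (λ ()) , z≤n

  fromSmallDegree : ∀ {k n} → RamseyBound k n → ∀ x l → deg l x + n ≤ length l →
                    HasIndependent (suc k) (x ∷ l)
  fromSmallDegree {n = n} bound x l le = fromNonNeighbours x l (bound _
    (+-cancelˡ-≤ (deg l x) n _ (≤-trans le (≤-reflexive (sym (deg-split x l))))))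

  -- R(3, k + 1) ≤ R(3, k) + k + 1: either `x` has k + 1 neighbours, which are independent, or it
  -- has at most k, which leaves at least n non-neighbours.
  ramsey-step : ∀ {k n} → RamseyBound k n → RamseyBound (suc k) (suc k + n)
  ramsey-step {k} {n} bound (x ∷ l) (s≤s k+n≤) with suc k ≤? deg l x
  ... | yes k<deg = fromNeighbours x l k<deg
  ... | no  k≮deg = fromSmallDegree bound x l (≤-trans (+-monoˡ-≤ n (≮⇒≥ k≮deg)) k+n≤)

  ramsey-2 : RamseyBound 2 3
  ramsey-2 = ramsey-step (ramsey-step ramsey-0)

  ramsey-3 : RamseyBound 3 6
  ramsey-3 = ramsey-step ramsey-2

  -- Degree at most 2 leaves at least 6 of the 8 others as non-neighbours, where R(3,3) ≤ 6 applies;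
  -- degree at least 4 gives four independent neighbours.
  fromIrregular : ∀ x l → length l ≡ 8 → deg l x ≢ 3 → HasIndependent 4 (x ∷ l)
  fromIrregular x l len deg≢3 with <-cmp (deg l x) 3
  ... | tri< (s≤s deg≤2) _ _ = fromSmallDegree ramsey-3 x l
                                 (≤-trans (+-monoˡ-≤ 6 deg≤2) (≤-reflexive (sym len)))
  ... | tri≈ _ deg≡3 _       = contradiction deg≡3 deg≢3
  ... | tri> _ _ 3<deg       = fromNeighbours x l 3<deg

  -- Another `ramsey-step` would give only 10; parity saves one vertex. The length is exact because
  -- the argument uses that 9 · 3 is odd.
  ramsey-4 : ∀ l → length l ≡ 9 → HasIndependent 4 l
  ramsey-4 l len with All.all? (λ x → deg l x ≟ 3) l
  ... | yes regular = contradiction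
          (subst (2 ∣_) (trans (sum-map-const regular) (cong (_* 3) len)) (2∣sum-deg l))
          (from-no (2 ∣? 27))
  ... | no irregular
          with find (¬All⇒Any¬ (λ x → deg l x ≟ 3) l irregular)
  ... | x , x∈l , deg≢3 with ∈-∃++ x∈l
  ... | ys , zs , refl = HasIndependent-resp-↭ (↭-sym p)
          (fromIrregular x (ys ++ zs) (suc-injective (trans (sym (↭-length p)) len))
            -- Removing `x` keeps its degree, as `x` is not adjacent to itself.
            (deg≢3 ∘ trans (trans (deg-↭ x p) (deg-cons-self x (ys ++ zs)))))
    where
    p : ys ++ [ x ] ++ zs ↭ x ∷ ys ++ zs
    p = shift x ys zs

-- Independence number of the 12-vertex graph.

module IndependenceNumber {a ℓ} {A : Set a} {E : Rel A ℓ} (E? : Decidable E) where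

  -- The largest size of a sublist of l which is independent and has no edge to c.
  α : List A → List A → ℕ
  α c []      = 0
  α c (x ∷ l) with any? (E? x) c
  ... | yes _ = α c l
  ... | no  _ = α c l ⊔ suc (α (x ∷ c) l)

  -- A skipped head falls under the left argument of the maximum; a chosen one falls under the right
  -- and moves from `s` to `c`.
  length≤α : ∀ {c s l} → s ⊆ l → (∀ {x y} → x ∈ s → y ∈ s → ¬ E x y) →
             (∀ {x y} → x ∈ s → y ∈ c → ¬ E x y) → length s ≤ α c l
  length≤α [] _ _ = z≤n
  length≤α {c} (x ∷ʳ s⊆l) s-indep s≁c with any? (E? x) c
  ... | yes _ = length≤α s⊆l s-indep s≁c
  ... | no  _ = m≤n⇒m≤n⊔o _ (length≤α s⊆l s-indep s≁c)
  length≤α {c} {l = x ∷ _} (refl ∷ s⊆l) s-indep s≁c with any? (E? x) c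
  ... | yes x~c = let y , y∈c , x~y = find x~c in contradiction x~y (s≁c (here refl) y∈c)
  ... | no  _   = m≤n⇒m≤o⊔n _ (s≤s (length≤α s⊆l (λ p q → s-indep (there p) (there q))
      λ { p (here refl) → s-indep (there p) (here refl) ; p (there q) → s≁c (there p) q }))

-- On representatives below 12 a difference ±1, ±5 modulo 13 is an absolute difference 1, 5 or 8.
Cyc : Rel (Fin 12) 0ℓ
Cyc i j = ∣ toℕ i - toℕ j ∣ ∈ 1 ∷ 5 ∷ 8 ∷ []

Cyc? : Decidable Cyc
Cyc? i j = ∣ toℕ i - toℕ j ∣ ∈? 1 ∷ 5 ∷ 8 ∷ []

Cyc-sym : Symmetric Cyc
Cyc-sym {i} {j} = subst (_∈ 1 ∷ 5 ∷ 8 ∷ []) (∣-∣-comm (toℕ i) (toℕ j))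

-- A finite check over all triples; behind it, {1, 5, 8, 12} is sum-free modulo 13.
Cyc-triangleFree : ∀ i j k → Cyc i j → Cyc j k → ¬ Cyc i k
Cyc-triangleFree = from-yes (all? λ i → all? λ j → all? λ k →
  Cyc? i j →-dec (Cyc? j k →-dec ¬? (Cyc? i k)))

-- `α [] (allFin 12)` evaluates to 4.
Cyc-α : ∀ {s} → s ⊆ allFin 12 → (∀ {i j} → i ∈ s → j ∈ s → ¬ Cyc i j) → length s ≤ 4
Cyc-α s⊆ s-indep = IndependenceNumber.length≤α Cyc? {c = []} s⊆ s-indep (λ _ ())

-- Embedding finite triangle-free graphs, and the two halves of the theorem.

module Henson {v e} (G : Graph v e) (U₃ : IsHensonU₃ G) where
  open Graph G
  open IsHensonU₃ U₃
  open Ramsey G triangleFree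

  -- Induced embeddings, so that they can be extended by a vertex: reflecting edges carries
  -- independent sets to independent sets, and injectivity keeps disjoint sets disjoint.
  Embedding : ∀ {n ℓ} → Rel (Fin n) ℓ → Set _
  Embedding {n} E = ∃[ f ] Injective _≡_ _≡_ f ×
    (∀ {i j : Fin n} → E i j → f i ~ f j) × (∀ {i j} → f i ~ f j → E i j)

  embed : ∀ {n ℓ} {E : Rel (Fin n) ℓ} → Decidable E → Symmetric E →
          (∀ i j k → E i j → E j k → ¬ E i k) → Embedding E
  embed {zero} _ _ _ = (λ ()) , (λ { {()} }) , (λ { {()} }) , (λ { {()} })
  embed {suc n} {E = E} E? E-sym E-tf
    with f , f-inj , f-pres , f-refl ←
      embed (λ i j → E? (suc i) (suc j)) E-sym (λ i j k → E-tf (suc i) (suc j) (suc k))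
    with w , w∉A , w∉B , w~A , w≁B ← extension
      (map f (filter (E? zero ∘ suc) (allFin n)))
      (map f (filter (¬? ∘ E? zero ∘ suc) (allFin n)))
      -- By injectivity a common element would come from one index both adjacent and not adjacent to
      -- `zero`.
      (λ (a∈ , b∈) → let i , i∈ , eq  = ∈-map⁻ f a∈
                         j , j∈ , eq′ = ∈-map⁻ f b∈
                     in proj₂ (∈-filter⁻ (¬? ∘ E? zero ∘ suc) {xs = allFin n} j∈)
                          (subst (E zero ∘ suc) (f-inj (trans (sym eq) eq′))
                            (proj₂ (∈-filter⁻ (E? zero ∘ suc) {xs = allFin n} i∈))))
      -- An edge between two images would reflect to a triangle through `zero`.
      (λ x∈ y∈ x~y → let i , i∈ , eq  = ∈-map⁻ f x∈
                         j , j∈ , eq′ = ∈-map⁻ f y∈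
                     in E-tf zero (suc i) (suc j)
                          (proj₂ (∈-filter⁻ (E? zero ∘ suc) {xs = allFin n} i∈))
                          (f-refl (subst₂ _~_ eq eq′ x~y))
                          (proj₂ (∈-filter⁻ (E? zero ∘ suc) {xs = allFin n} j∈)))
    = g , g-inj , g-pres , g-refl
    where
    g : Fin (suc n) → V
    g zero    = w
    g (suc i) = f i

    inA : ∀ {i} → E zero (suc i) → f i ∈ map f (filter (E? zero ∘ suc) (allFin n))
    inA {i} p = ∈-map⁺ f (∈-filter⁺ (E? zero ∘ suc) (∈-allFin i) p)

    inB : ∀ {i} → ¬ E zero (suc i) → f i ∈ map f (filter (¬? ∘ E? zero ∘ suc) (allFin n))
    inB {i} p = ∈-map⁺ f (∈-filter⁺ (¬? ∘ E? zero ∘ suc) (∈-allFin i) p)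

    -- The two sets given to `extension` together exhaust the image of `f`.
    w≢f : ∀ i → w ≢ f i
    w≢f i refl with E? zero (suc i)
    ... | yes p = w∉A (inA p)
    ... | no ¬p = w∉B (inB ¬p)

    g-inj : Injective _≡_ _≡_ g
    g-inj {zero}  {zero}  _  = refl
    g-inj {zero}  {suc j} eq = contradiction eq (w≢f j)
    g-inj {suc i} {zero}  eq = contradiction (sym eq) (w≢f i)
    g-inj {suc i} {suc j} eq = cong suc (f-inj eq)

    -- A loop is a degenerate triangle.
    E-irrefl : ∀ {i} → ¬ E i i
    E-irrefl {i} p = E-tf i i i p p p

    w~f⇒E : ∀ {i} → w ~ f i → E zero (suc i)
    w~f⇒E {i} w~f with E? zero (suc i)
    ... | yes p = p
    ... | no ¬p = contradiction w~f (w≁B (inB ¬p))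

    g-pres : ∀ {i j} → E i j → g i ~ g j
    g-pres {zero}  {zero}  p = contradiction p E-irrefl
    g-pres {zero}  {suc j} p = w~A (inA p)
    g-pres {suc i} {zero}  p = ~-sym (w~A (inA (E-sym p)))
    g-pres {suc i} {suc j} p = f-pres p

    g-refl : ∀ {i j} → g i ~ g j → E i j
    g-refl {zero}  {zero}  p = contradiction p (~-irrefl refl)
    g-refl {zero}  {suc j} p = w~f⇒E p
    g-refl {suc i} {zero}  p = E-sym (w~f⇒E (~-sym p))
    g-refl {suc i} {suc j} p = f-refl p

  -- The extension property with A = `s` and B empty gives `y`; every position in `s` then counts,
  -- and those in `t` can only add.
  commonNeighbour : ∀ {n k} (x : Fin n → V) → HasIndependent k (tabulate x) →
                    ∃[ y ] k ≤ degreeInto G x y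
  commonNeighbour {k = k} x (s , t , p , indep , k≤)
    with y , _ , _ , y~s , _ ← extension s [] (λ ()) indep
    = y , (begin
      k                                                ≤⟨ k≤ ⟩
      length s                                         ≡⟨ cong length (filter-all (_~? y) (All.tabulate (~-sym ∘ y~s))) ⟨
      length (filter (_~? y) s)                        ≤⟨ m≤m+n _ _ ⟩
      length (filter (_~? y) s) + length (filter (_~? y) t) ≡⟨ length-++ (filter (_~? y) s) ⟨
      length (filter (_~? y) s ++ filter (_~? y) t)    ≡⟨ cong length (filter-++ (_~? y) s t) ⟨
      length (filter (_~? y) (s ++ t))                 ≡⟨ ↭-length (filter-↭ (_~? y) p) ⟩
      length (filter (_~? y) (tabulate x))             ≡⟨ length-filter-tabulate (_~? y) x (λ i → i) ⟩
      degreeInto G x y                                 ∎)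
    where open ≤-Reasoning

  satisfies-𝒟₃ : 𝒟 G 3
  satisfies-𝒟₃ 1 _ _ x = commonNeighbour x (ramsey-2 _ (≤-reflexive (sym (length-tabulate x))))
  satisfies-𝒟₃ 2 _ _ x = commonNeighbour x (ramsey-3 _ (≤-reflexive (sym (length-tabulate x))))
  satisfies-𝒟₃ 3 _ _ x = commonNeighbour x (ramsey-4 _ (length-tabulate x))
  satisfies-𝒟₃ (suc (suc (suc (suc _)))) _ (s≤s (s≤s (s≤s ())))

  -- The embedded vertices are the sequence for m = 4. The indices counted at `y` are independent,
  -- as an edge among them would close a triangle with `y`, so there are at most 4.
  Cyc-embedded⇒¬𝒟₄ : Embedding Cyc → ¬ 𝒟 G 4
  Cyc-embedded⇒¬𝒟₄ (f , _ , f-pres , _) 𝒟₄ with y , 5≤deg ← 𝒟₄ 4 (s≤s z≤n) ≤-refl f =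
    <⇒≱ 5≤deg (Cyc-α (filter-⊆ f~y? (allFin 12)) λ {i} {j} i∈ j∈ i~j →
      triangleFree (f-pres {i} {j} i~j) (f~y j∈) (f~y i∈))
    where
    f~y? : U.Decidable (λ i → f i ~ y)
    f~y? i = f i ~? y
    f~y : ∀ {i} → i ∈ filter f~y? (allFin 12) → f i ~ y
    f~y = proj₂ ∘ ∈-filter⁻ f~y? {xs = allFin 12}

  fails-𝒟₄ : ¬ 𝒟 G 4
  fails-𝒟₄ = Cyc-embedded⇒¬𝒟₄ (embed Cyc? (λ {i} {j} → Cyc-sym {i} {j}) Cyc-triangleFree)

theorem5p3 : ∀ {v e : Level} (G : Graph v e) → IsHensonU₃ G → 𝒟 G 3 × ¬ 𝒟 G 4
theorem5p3 G U₃ = satisfies-𝒟₃ , fails-𝒟₄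
  where open Henson G U₃
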